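{- Let $R$ be an orthogonal term rewriting system over a signature $\Sigma$. If there exists a termination-disproving automaton with a final sink (TDA-S) for $R$, then $R$ is not terminating.
   Context: A signature $\Sigma$ is a non-empty finite set of function symbols with fixed arities; $\Sigma^{(n)}$ is the set of symbols of arity $n$. $\mathcal V$ is a countably infinite set of variables, $\mathcal T_\Sigma(\mathcal V)$ the set of terms, $\mathcal T_\Sigma$ the set of ground terms, $\mathsf{FV}(t)$ the set of variables of $t$, $\mathcal C_\Sigma$ the set of ground contexts (ground terms over $\Sigma$ extended by a constant $\square$, the hole, occurring exactly once). A term rewriting system (TRS) $R$ over $\Sigma$ is a set of rules $l\to r$ with $l,r\in\mathcal T_\Sigma(\mathcal V)$ and $\mathsf{FV}(r)\subseteq \mathsf{FV}(l)$. It is left-linear if each variable of $l$ occurs exactly once in $l$ for every rule $l\to r$. A left-linear TRS is orthogonal if no two (possibly the same) rules overlap, i.e. the left-hand side of one rule is not unifiable (after renaming variables apart) with any non-variable subterm of the left-hand side of the other, except for the trivial overlap of a rule with itself at the root. The rewrite relation is $C[l\alpha]\to_R C[r\alpha]$ for contexts $C$, rules $l\to r\in R$ and substitutions $\alpha$. A redex is a term of the form $l\alpha$ with $l\to r\in R$. A term is a normal form if it has no $\to_R$-successor; $\mathsf{NF}(R)$ is the set of normal forms. $R$ is terminating if there is no infinite sequence $t_0\to_R t_1\to_R\cdots$ of terms in $\mathcal T_\Sigma(\mathcal V)$. A step $s\to_R t$ is innermost, written $s\to^{\mathrm{i}}_R t$, if no proper subterm of the contracted redex is itself a redex. A (non-deterministic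 bottom-up) tree automaton is $A=\langle Q,\Sigma,F,\Delta\rangle$ with $Q$ a finite set of states, $F\subseteq Q$ the final states, and $\Delta$ a set of transition rules $f(q_1,\dots,q_n)\rightsquigarrow q$ with $f\in\Sigma^{(n)}$, $q_1,\dots,q_n,q\in Q$. $\rightsquigarrow_\Delta$ is the rewrite relation on $\mathcal T_{\Sigma\cup Q}$ (states viewed as constants) induced by $\Delta$. $\mathcal L(A,q)=\{t\in\mathcal T_\Sigma\mid t\rightsquigarrow_\Delta^* q\}$ and $\mathcal L(A)=\bigcup_{q\in F}\mathcal L(A,q)$. A state $q$ is reachable if $\mathcal L(A,q)\neq\emptyset$. A state $q$ is a sink state if for every $f\in\Sigma^{(n)}$ with $n>0$ and all $q_1,\dots,q_n\in Q$ with $q_i=q$ for some $i$, the rule $f(q_1,\dots,q_n)\rightsquigarrow q$ is in $\Delta$ and $f(q_1,\dots,q_n)\rightsquigarrow q'$ is not in $\Delta$ for any $q'\neq q$. A TDA-S for an orthogonal TRS $R$ over $\Sigma$ is a tree automaton $A=\langle Q,\Sigma,\{q_F\},\Delta\rangle$ with $q_F\in Q$ such that: (1) $q_F$ is a sink state and reachable; (2) $\mathcal L(A)\cap\mathsf{NF}(R)=\emptyset$; (3) for all $q\in Q$ and $t,u\in\mathcal T_\Sigma$ with $t\to^{\mathrm{i}}_R u$, $t\in\mathcal L(A,q)$ implies $u\in\mathcal L(A,q)\cup\mathcal L(A)$. -}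

module Defs where

open import Data.Empty using (⊥; ⊥-elim)
open import Data.Fin.Base using (Fin)
open import Data.List.Base using (List; []; [_]; _++_)
open import Data.List.Membership.Propositional using (_∈_)
open import Data.List.Relation.Unary.Unique.Propositional using (Unique)
open import Data.Nat.Base using (ℕ; suc)
open import Data.Product.Base using (∃; _×_; _,_)
open import Data.Sum.Base using (_⊎_; inj₁; inj₂)
open import Data.Vec.Base using (Vec; []; _∷_; map)
import Data.Vec.Membership.Propositional as Vec
open import Function.Base using (_∘_)
open import Function.Bundles using (_↔_)
open import Level using (0ℓ)
open import Relation.Binary.Construct.Closure.ReflexiveTransitive using (Star)
open import Relation.Binary.Core using (Rel)
open import Relation.Binary.PropositionalEquality.Core using (_≡_; _≢_)
open import Relation.Binary.Rewriting using (IsNormalForm)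
open import Relation.Nullary.Negation.Core using (¬_)
open import Relation.Unary using (Pred; _≐_; _∪_; _∩_; ｛_｝; Empty)
  renaming (_∈_ to _∈ₚ_)

Finite : Set → Set
Finite A = ∃ λ n → A ↔ Fin n

record Signature : Set₁ where
  field
    Symbol   : Set
    arity    : Symbol → ℕ
    finite   : Finite Symbol
    nonEmpty : Symbol

V : Set
V = ℕ

module _ (Sig : Signature) where
  open Signature Sig

  -- Terms with leaves from X. With X = V these are the terms with variables,
  -- with X = ⊥ the ground terms, and with X the set of states of an automaton
  -- the ground terms over the signature extended by the states as constants.
  data Term (X : Set) : Set where
    var : X → Term X
    fun : (f : Symbol) → Vec (Term X) (arity f) → Term X

  -- Contexts: □ occurs exactly once. Args X n are the argument lists of length
  -- n in which exactly one entry is a context and all others are terms.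
  mutual
    data Context (X : Set) : Set where
      □   : Context X
      fun : (f : Symbol) → Args X (arity f) → Context X

    data Args (X : Set) : ℕ → Set where
      here  : ∀ {n} → Context X → Vec (Term X) n → Args X (suc n)
      there : ∀ {n} → Term X → Args X n → Args X (suc n)

module _ {Sig : Signature} where
  open Signature Sig

  infix 9 _⟦_⟧ _⟦_⟧*
  infix 9 _⟨_⟩ _⟨_⟩*

  mutual
    _⟦_⟧ : ∀ {X} → Context Sig X → Term Sig X → Term Sig X
    □        ⟦ t ⟧ = t
    fun f Cs ⟦ t ⟧ = fun f (Cs ⟦ t ⟧*)

    _⟦_⟧* : ∀ {X n} → Args Sig X n → Term Sig X → Vec (Term Sig X) n
    here C ts  ⟦ t ⟧* = C ⟦ t ⟧ ∷ ts
    there s Cs ⟦ t ⟧* = s ∷ Cs ⟦ t ⟧*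

  mutual
    _⟨_⟩ : ∀ {X Y} → Term Sig X → (X → Term Sig Y) → Term Sig Y
    var x    ⟨ α ⟩ = α x
    fun f ts ⟨ α ⟩ = fun f (ts ⟨ α ⟩*)

    _⟨_⟩* : ∀ {X Y n} → Vec (Term Sig X) n → (X → Term Sig Y) → Vec (Term Sig Y) n
    []       ⟨ α ⟩* = []
    (t ∷ ts) ⟨ α ⟩* = t ⟨ α ⟩ ∷ ts ⟨ α ⟩*

  rename : ∀ {X Y} → (X → Y) → Term Sig X → Term Sig Y
  rename ρ t = t ⟨ var ∘ ρ ⟩

  fromGround : ∀ {X} → Term Sig ⊥ → Term Sig X
  fromGround = rename ⊥-elim

  -- All occurrences of variables, from left to right, with repetitions.
  mutual
    vars : ∀ {X} → Term Sig X → List X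
    vars (var x)    = [ x ]
    vars (fun f ts) = vars* ts

    vars* : ∀ {X n} → Vec (Term Sig X) n → List X
    vars* []       = []
    vars* (t ∷ ts) = vars t ++ vars* ts

  NonVariable : ∀ {X} → Term Sig X → Set
  NonVariable t = ∀ x → t ≢ var x

  Unifiable : ∀ {X} → Rel (Term Sig X) 0ℓ
  Unifiable {X} s t = ∃ λ (σ : X → Term Sig X) → s ⟨ σ ⟩ ≡ t ⟨ σ ⟩

  data ContextClosure {X} (_↦_ : Rel (Term Sig X) 0ℓ) : Rel (Term Sig X) 0ℓ where
    inContext : ∀ (C : Context Sig X) {s t} → s ↦ t →
                ContextClosure _↦_ (C ⟦ s ⟧) (C ⟦ t ⟧)

record TRS (Sig : Signature) : Set₁ where
  field
    Rule : Rel (Term Sig V) 0ℓ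
    FV⊆  : ∀ {l r x} → Rule l r → x ∈ vars r → x ∈ vars l

module _ {Sig : Signature} (R : TRS Sig) where
  open TRS R

  LeftLinear : Set
  LeftLinear = ∀ {l r} → Rule l r → Unique (vars l)

  -- A unifiable pair consisting of a left-hand side l₁ and a non-variable
  -- subterm s of a left-hand side l₂, with variables renamed apart by
  -- inj₁ and inj₂, arises only from a rule and itself at the root.
  NonOverlapping : Set
  NonOverlapping = ∀ {l₁ r₁ l₂ r₂} → Rule l₁ r₁ → Rule l₂ r₂ →
    ∀ C s → l₂ ≡ C ⟦ s ⟧ → NonVariable s →
    Unifiable {X = V ⊎ V} (rename inj₁ l₁) (rename inj₂ s) →
    (l₁ ≡ l₂ × r₁ ≡ r₂) × C ≡ □

  Orthogonal : Set
  Orthogonal = LeftLinear × NonOverlapping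

  data Contraction : Rel (Term Sig V) 0ℓ where
    contract : ∀ {l r} → Rule l r → (α : V → Term Sig V) →
               Contraction (l ⟨ α ⟩) (r ⟨ α ⟩)

  Redex : Pred (Term Sig V) 0ℓ
  Redex t = ∃ λ u → Contraction t u

  Step : Rel (Term Sig V) 0ℓ
  Step = ContextClosure Contraction

  NF : Pred (Term Sig V) 0ℓ
  NF = IsNormalForm Step

  Terminating : Set
  Terminating = ¬ ∃ λ (t : ℕ → Term Sig V) → ∀ n → Step (t n) (t (suc n))

  InnermostContraction : Rel (Term Sig V) 0ℓ
  InnermostContraction s t =
    Contraction s t × (∀ C u → s ≡ C ⟦ u ⟧ → C ≢ □ → ¬ Redex u)

  InnermostStep : Rel (Term Sig V) 0ℓ
  InnermostStep = ContextClosure InnermostContraction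

record TreeAutomaton (Sig : Signature) : Set₁ where
  open Signature Sig
  field
    State        : Set
    finiteStates : Finite State
    Final        : Pred State 0ℓ
    Δ            : (f : Symbol) → Vec State (arity f) → State → Set

module _ {Sig : Signature} (A : TreeAutomaton Sig) where
  open Signature Sig
  open TreeAutomaton A

  data Transition : Rel (Term Sig State) 0ℓ where
    transition : ∀ {f qs q} → Δ f qs q → Transition (fun f (map var qs)) (var q)

  Lang : State → Pred (Term Sig ⊥) 0ℓ
  Lang q t = Star (ContextClosure Transition) (fromGround t) (var q)

  L : Pred (Term Sig ⊥) 0ℓ
  L t = ∃ λ q → q ∈ₚ Final × t ∈ₚ Lang q

  Reachable : State → Set
  Reachable q = ∃ λ t → t ∈ₚ Lang q

  -- The premise q ∈ qs implies that f has positive arity.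
  Sink : State → Set
  Sink q = ∀ f (qs : Vec State (arity f)) → q Vec.∈ qs →
    Δ f qs q × (∀ q′ → q′ ≢ q → ¬ Δ f qs q′)

record IsTDAS {Sig : Signature} (R : TRS Sig) (A : TreeAutomaton Sig) : Set where
  open TreeAutomaton A
  field
    qF        : State
    final     : Final ≐ ｛ qF ｝
    sink      : Sink A qF
    reachable : Reachable A qF
    noNF      : Empty (L A ∩ (NF R ∘ fromGround))
    closed    : ∀ q t u → InnermostStep R (fromGround t) (fromGround u) →
                t ∈ₚ Lang A q → u ∈ₚ (Lang A q ∪ L A)

{-# OPTIONS --safe #-}
module Submission where

-- Each ground term accepted by the automaton has a redex, hence an innermost
-- redex. Contracting it gives a ground term, as a step introduces no variables,
-- and condition (3) for the final state says that this term is accepted again.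

open import Defs
open import Axiom.ExcludedMiddle using (ExcludedMiddle)
open import Data.Empty using (⊥; ⊥-elim)
open import Data.List.Base using ([]; _++_; concatMap)
open import Data.List.Properties
  using (++-conicalˡ; ++-conicalʳ; ++-identityʳ; concatMap-++)
open import Data.List.Relation.Binary.Subset.Propositional using (_⊆_)
open import Data.List.Relation.Binary.Subset.Propositional.Properties
  using (++⁺; concatMap⁺; ⊆-refl; ⊆[]⇒≡[])
open import Data.Nat.Base using (ℕ; zero; suc)
open import Data.Product.Base using (∃; _,_; proj₁; proj₂; map₂)
open import Data.Sum.Base using (_⊎_; inj₁; inj₂)
open import Data.Vec.Base using (Vec; []; _∷_)
open import Function.Base using (_∘_)
open import Level using (0ℓ)
open import Relation.Binary.Core using (Rel; _⇒_)
open import Relation.Binary.PropositionalEquality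
  using (_≡_; refl; sym; trans; cong₂; subst; subst₂)
open import Relation.Nullary.Decidable.Core using (yes; no; decidable-stable)
open import Relation.Nullary.Negation.Core using (¬_; contradiction)

module _ {Sig : Signature} where

  mutual
    vars-⟨⟩ : ∀ {X Y} (t : Term Sig X) (α : X → Term Sig Y) →
              vars (t ⟨ α ⟩) ≡ concatMap (vars ∘ α) (vars t)
    vars-⟨⟩ (var x)    α = sym (++-identityʳ (vars (α x)))
    vars-⟨⟩ (fun f ts) α = vars*-⟨⟩* ts α

    vars*-⟨⟩* : ∀ {X Y n} (ts : Vec (Term Sig X) n) (α : X → Term Sig Y) →
                vars* (ts ⟨ α ⟩*) ≡ concatMap (vars ∘ α) (vars* ts)
    vars*-⟨⟩* []       α = refl
    vars*-⟨⟩* (t ∷ ts) α =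
      trans (cong₂ _++_ (vars-⟨⟩ t α) (vars*-⟨⟩* ts α))
            (sym (concatMap-++ (vars ∘ α) (vars t) (vars* ts)))

  mutual
    vars-⟦⟧⁺ : ∀ {X} (C : Context Sig X) {s t} →
               vars s ⊆ vars t → vars (C ⟦ s ⟧) ⊆ vars (C ⟦ t ⟧)
    vars-⟦⟧⁺ □          s⊆t = s⊆t
    vars-⟦⟧⁺ (fun f Cs) s⊆t = vars*-⟦⟧*⁺ Cs s⊆t

    vars*-⟦⟧*⁺ : ∀ {X n} (Cs : Args Sig X n) {s t} →
                 vars s ⊆ vars t → vars* (Cs ⟦ s ⟧*) ⊆ vars* (Cs ⟦ t ⟧*)
    vars*-⟦⟧*⁺ (here C ts)  s⊆t = ++⁺ (vars-⟦⟧⁺ C s⊆t) ⊆-refl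
    vars*-⟦⟧*⁺ (there u Cs) s⊆t = ++⁺ (⊆-refl {x = vars u}) (vars*-⟦⟧*⁺ Cs s⊆t)

  fromGround* : ∀ {X n} → Vec (Term Sig ⊥) n → Vec (Term Sig X) n
  fromGround* ts = ts ⟨ var ∘ ⊥-elim ⟩*

  mutual
    vars-fromGround : ∀ {X} (t : Term Sig ⊥) → vars (fromGround {X = X} t) ≡ []
    vars-fromGround (fun f ts) = vars*-fromGround ts

    vars*-fromGround : ∀ {X n} (ts : Vec (Term Sig ⊥) n) →
                       vars* (fromGround* {X = X} ts) ≡ []
    vars*-fromGround []       = refl
    vars*-fromGround (t ∷ ts) =
      cong₂ _++_ (vars-fromGround t) (vars*-fromGround ts)

  mutual
    -- The leaf case cannot occur, since `vars (var x)` is non-empty; every other node is rebuilt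
    -- over `⊥`.
    toGround : ∀ {X} (t : Term Sig X) → vars t ≡ [] →
               ∃ λ u → t ≡ fromGround u
    toGround (fun f ts) vars≡[] with us , refl ← toGround* ts vars≡[] =
      fun f us , refl

    toGround* : ∀ {X n} (ts : Vec (Term Sig X) n) → vars* ts ≡ [] →
                ∃ λ us → ts ≡ fromGround* us
    toGround* []       _       = [] , refl
    toGround* (t ∷ ts) vars≡[]
      with u  , refl ← toGround t (++-conicalˡ (vars t) (vars* ts) vars≡[])
         | us , refl ← toGround* ts (++-conicalʳ (vars t) (vars* ts) vars≡[])
      = u ∷ us , refl

  ContextClosure⁺ : ∀ {X} {S T : Rel (Term Sig X) 0ℓ} →
                    S ⇒ T → ContextClosure S ⇒ ContextClosure T
  ContextClosure⁺ S⇒T (inContext C s) = inContext C (S⇒T s)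

module _ {Sig : Signature} (R : TRS Sig) where
  open TRS R

  InnermostStep⇒Step : InnermostStep R ⇒ Step R
  InnermostStep⇒Step = ContextClosure⁺ proj₁

  -- By `vars-⟨⟩`, the variables of an instance are collected from `α x` over the variables `x` of
  -- the rule side. The inclusion `FV⊆` therefore survives instantiation, and then the surrounding
  -- context.
  step-vars-⊆ : ∀ {s t} → Step R s t → vars t ⊆ vars s
  step-vars-⊆ (inContext C (contract {l} {r} rule α)) =
    vars-⟦⟧⁺ C (subst₂ _⊆_ (sym (vars-⟨⟩ r α)) (sym (vars-⟨⟩ l α))
                 (concatMap⁺ (vars ∘ α) (FV⊆ rule)))

  -- Steps relate terms over `V`, whereas `closed` speaks of ground terms; this passes from the
  -- former to the latter.
  step-fromGround : ∀ t {v} → Step R (fromGround t) v →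
                    ∃ λ u → v ≡ fromGround u
  step-fromGround t {v} step =
    toGround v (⊆[]⇒≡[] (subst (vars v ⊆_) (vars-fromGround t)
                           (step-vars-⊆ step)))

  -- Phrased by decompositions to match the side condition of `InnermostContraction`: the contexts
  -- other than `□` that decompose `fun f ts` are those that `RedexFree* ts` ranges over.
  RedexFree : Term Sig V → Set
  RedexFree t = ∀ C s → t ≡ C ⟦ s ⟧ → ¬ Redex R s

  RedexFree* : ∀ {n} → Vec (Term Sig V) n → Set
  RedexFree* ts = ∀ Cs s → ts ≡ Cs ⟦ s ⟧* → ¬ Redex R s

  data InnermostStep* : ∀ {n} → Rel (Vec (Term Sig V) n) 0ℓ where
    inArgs : ∀ {n} (Cs : Args Sig V n) {s t} → InnermostContraction R s t →
             InnermostStep* (Cs ⟦ s ⟧*) (Cs ⟦ t ⟧*)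

  module _ (em : ExcludedMiddle 0ℓ) where

    mutual
      -- A bottom-up search, preferring the leftmost argument that has a step. The root is tested
      -- only once all arguments are redex-free, so a redex found there is innermost. Excluded
      -- middle decides the test, as `Rule` is an arbitrary relation.
      innermostStep⊎redexFree : ∀ t → ∃ (InnermostStep R t) ⊎ RedexFree t
      innermostStep⊎redexFree (var x) with em {Redex R (var x)}
      ... | yes (u , c) =
        inj₁ (u , inContext □ (c , λ { □ _ _ □≢□ _ → □≢□ refl
                                     ; (fun _ _) _ () }))
      ... | no ¬redex = inj₂ λ { □ _ refl → ¬redex ; (fun _ _) _ () }
      innermostStep⊎redexFree (fun f ts) with innermostStep*⊎redexFree* ts
      ... | inj₁ (_ , inArgs Cs c) = inj₁ (_ , inContext (fun f Cs) c)
      ... | inj₂ free with em {Redex R (fun f ts)}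
      ...   | yes (u , c) =
        inj₁ (u , inContext □ (c , λ { □ _ _ □≢□ _ → □≢□ refl
                                     ; (fun _ Cs) s refl _ → free Cs s refl }))
      ...   | no ¬redex =
        inj₂ λ { □ _ refl → ¬redex ; (fun _ Cs) s refl → free Cs s refl }

      innermostStep*⊎redexFree* : ∀ {n} (ts : Vec (Term Sig V) n) →
                                  ∃ (InnermostStep* ts) ⊎ RedexFree* ts
      innermostStep*⊎redexFree* [] = inj₂ λ ()
      innermostStep*⊎redexFree* (t ∷ ts)
        with innermostStep⊎redexFree t | innermostStep*⊎redexFree* ts
      ... | inj₁ (_ , inContext C c) | _ = inj₁ (_ , inArgs (here C ts) c)
      ... | inj₂ _ | inj₁ (_ , inArgs Cs c) = inj₁ (_ , inArgs (there t Cs) c)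
      ... | inj₂ free | inj₂ free* =
        inj₂ λ { (here C _) s refl → free C s refl
               ; (there _ Cs) s refl → free* Cs s refl }

    -- The redex of the given step rules out the redex-free outcome of the search. The innermost
    -- step found may contract another redex and need not lead to `u`.
    step⇒innermostStep : ∀ {t u} → Step R t u → ∃ (InnermostStep R t)
    step⇒innermostStep {t} (inContext C {s} c)
      with innermostStep⊎redexFree t
    ... | inj₁ step = step
    ... | inj₂ free = contradiction (_ , c) (free C s refl)

    ¬NF⇒innermostStep : ∀ {t} → ¬ NF R t → ∃ (InnermostStep R t)
    ¬NF⇒innermostStep ¬nf =
      -- `NF` is itself a negation, so `¬nf` is a double negation, which excluded middle removes.
      step⇒innermostStep (proj₂ (decidable-stable em ¬nf))

    module _ {A : TreeAutomaton Sig} (tdas : IsTDAS R A) where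
      open IsTDAS tdas

      -- Acceptance is carried along with the term, so that source and target have the same type and
      -- the construction can be iterated.
      step-in-L : ((t , _) : ∃ (L A)) →
                  ∃ λ ((u , _) : ∃ (L A)) → Step R (fromGround t) (fromGround u)
      step-in-L (t , q , q∈F , t∈Lq)
        with v , step ← ¬NF⇒innermostStep (λ nf → noNF t ((q , q∈F , t∈Lq) , nf))
        with u , refl ← step-fromGround t (InnermostStep⇒Step step)
        with closed q t u step t∈Lq
      -- As `q` is final, both outcomes of `closed` place `u` in `L A`.
      ... | inj₁ u∈Lq = (u , q , q∈F , u∈Lq) , InnermostStep⇒Step step
      ... | inj₂ u∈L  = (u , u∈L) , InnermostStep⇒Step step

      derivation : ℕ → ∃ (L A)
      -- The start is the term that witnesses reachability of `qF`; `proj₂ final` is the inclusion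
      -- of the singleton of `qF` in `Final`.
      derivation zero    = map₂ (λ t∈Lq → qF , proj₂ final refl , t∈Lq) reachable
      derivation (suc n) = proj₁ (step-in-L (derivation n))

theorem4 : ExcludedMiddle 0ℓ →
    (Sig : Signature) (R : TRS Sig) → Orthogonal R →
    (∃ λ (A : TreeAutomaton Sig) → IsTDAS R A) →
    ¬ Terminating R
theorem4 em Sig R _ (A , tdas) terminating =
  terminating ( fromGround ∘ proj₁ ∘ derivation R em tdas
              -- Each step comes from the same call that defines the next member of the sequence, so
              -- the endpoints agree by definition.
              , λ n → proj₂ (step-in-L R em tdas (derivation R em tdas n)))
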